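{- Let $X$ be a normal modal logic and let $I$ be an index set with $\omega\subseteq I$. Suppose that $X$ is complete with respect to a set of Kripke frames $F=\{(G_\alpha,R_\alpha):\alpha\in I\}$, where for every $\alpha\in I$, $G_\alpha$ is a nonempty infinite set and $R_\alpha$ is an accessibility relation (a binary relation) on $G_\alpha$. Let $H=\{(G_i^*,R_i^*): i\in\omega\}$ be a set of Kripke frames such that for every $i\in\omega$: $$G_i^*=\{*,g_0,g_1,\dots,g_i\}\cup G_{\omega i},$$ where $G_{\omega i}=\{\eta_{ij}: j\in\omega\}$ has cardinality $\aleph_0$, $\{*,g_0,\dots,g_i\}\cap G_{\omega i}=\emptyset$, the elements $*,g_0,\dots,g_i$ are distinct, and $$R_i^*=\{(*,g_j):0\le j\le i\}\cup\{(\eta,\eta):\eta\in G_{\omega i}\}.$$ If $H\subseteq F$, then $B$-translation is faithful with respect to $X$.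
   Context: The system $\mathbf{L_1}$ (Leśniewski's propositional ontology): fix a countably infinite set of name variables. The atomic formulas are exactly the expressions $\epsilon ab$ with $a,b$ name variables (possibly equal); formulas are built from atomic formulas by $\vee$ and $\neg$, the other connectives being the usual classical abbreviations. $\mathbf{L_1}$ is a Hilbert-style system of classical propositional logic (with modus ponens) over these formulas with the additional axiom schemata, for all name variables $a,b,c$: (Ax1) $\epsilon ab \supset \epsilon aa$; (Ax2) $(\epsilon ab \wedge \epsilon bc) \supset \epsilon ac$; (Ax3) $(\epsilon ab \wedge \epsilon bc) \supset \epsilon ba$. $B$-translation: to each name variable $a$ corresponds a propositional variable $p_a$, with distinct name variables corresponding to distinct propositional variables. $B$ maps formulas of $\mathbf{L_1}$ to propositional modal formulas by $B(\phi\vee\psi)=B(\phi)\vee B(\psi)$, $B(\neg\phi)=\neg B(\phi)$, $B(\epsilon ab)=p_a\wedge\Box(p_a\supset p_b)\wedge\bigl(p_b\supset\Box(p_b\supset p_a)\bigr)$. $B$-translation is faithful with respect to a modal logic $X$ if for every formula $\phi$ of $\mathbf{L_1}$, $\vdash_X B(\phi)$ implies $\vdash_{\mathbf{L_1}}\phi$. A normal modal logic is a set $X$ of propositional modal formulas with $\mathbf{K}\subseteq X$ that is closed under modus ponens, substitution and necessitation. $X$ is complete with respect to a set $F$ of Kripke frames if, for every modal formula $\chi$, $\vdash_X\chi$ holds if and only if $\chi$ is valid in every frame in $F$. -}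

module Defs where

open import Data.Fin.Base using (Fin)
open import Data.Nat.Base using (ℕ; suc)
open import Data.Product.Base using (_×_; ∃)
open import Data.Sum.Base using (_⊎_)
open import Function.Bundles using (_⇔_; _⤖_; _↣_; module Injection)
open import Function.Definitions using (Injective)
open import Level using (Level; 0ℓ; _⊔_) renaming (suc to lsuc)
open import Relation.Binary.Core using (Rel)
open import Relation.Binary.PropositionalEquality.Core using (_≡_; _≢_)
open import Relation.Nullary.Negation.Core using (¬_)
open import Relation.Unary using (Pred; _∈_; _⊆_)

private
  variable
    i ℓ x : Level

-- The Hilbert–Ackermann axioms for classical propositional logic over the
-- primitives ∨ and ∼; the rule of modus ponens is added by each system below.

module Classical {Formula : Set} (_∨_ : Formula → Formula → Formula)
                 (∼_ : Formula → Formula) where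

  infixr 7 _∧_
  infixr 5 _⊃_

  _⊃_ : Formula → Formula → Formula
  φ ⊃ ψ = (∼ φ) ∨ ψ

  _∧_ : Formula → Formula → Formula
  φ ∧ ψ = ∼ ((∼ φ) ∨ (∼ ψ))

  data Axiom : Pred Formula 0ℓ where
    idem : ∀ φ → Axiom ((φ ∨ φ) ⊃ φ)
    weak : ∀ φ ψ → Axiom (φ ⊃ (φ ∨ ψ))
    perm : ∀ φ ψ → Axiom ((φ ∨ ψ) ⊃ (ψ ∨ φ))
    sum  : ∀ φ ψ χ → Axiom ((ψ ⊃ χ) ⊃ ((φ ∨ ψ) ⊃ (φ ∨ χ)))

Name PVar : Set
Name = ℕ
PVar = ℕ

module L₁ where

  infix  8 ∼_
  infixr 6 _∨_
  infix  3 ⊢_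

  data Formula : Set where
    ε   : Name → Name → Formula
    _∨_ : Formula → Formula → Formula
    ∼_  : Formula → Formula

  open Classical _∨_ ∼_ public

  data ⊢_ : Pred Formula 0ℓ where
    classical : ∀ {φ} → Axiom φ → ⊢ φ
    ax1 : ∀ a b → ⊢ ε a b ⊃ ε a a
    ax2 : ∀ a b c → ⊢ (ε a b ∧ ε b c) ⊃ ε a c
    ax3 : ∀ a b c → ⊢ (ε a b ∧ ε b c) ⊃ ε b a
    mp  : ∀ {φ ψ} → ⊢ φ ⊃ ψ → ⊢ φ → ⊢ ψ

module Modal where

  infix  8 ∼_ □_
  infixr 6 _∨_

  data Formula : Set where
    var : PVar → Formula
    _∨_ : Formula → Formula → Formula
    ∼_  : Formula → Formula
    □_  : Formula → Formula

  open Classical _∨_ ∼_ public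

  substitute : (PVar → Formula) → Formula → Formula
  substitute σ (var q) = σ q
  substitute σ (φ ∨ ψ) = substitute σ φ ∨ substitute σ ψ
  substitute σ (∼ φ)   = ∼ substitute σ φ
  substitute σ (□ φ)   = □ substitute σ φ

  data K : Pred Formula 0ℓ where
    classical    : ∀ {φ} → Axiom φ → K φ
    distribution : ∀ φ ψ → K (□ (φ ⊃ ψ) ⊃ (□ φ ⊃ □ ψ))
    mp           : ∀ {φ ψ} → K (φ ⊃ ψ) → K φ → K ψ
    nec          : ∀ {φ} → K φ → K (□ φ)

  -- For a logic X given as a set of formulas, ⊢_X χ is written χ ∈ X.
  record IsNormal (X : Pred Formula x) : Set x where
    field
      K⊆         : K ⊆ X
      mp-closed  : ∀ {φ ψ} → (φ ⊃ ψ) ∈ X → φ ∈ X → ψ ∈ X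
      sub-closed : ∀ σ {φ} → φ ∈ X → substitute σ φ ∈ X
      nec-closed : ∀ {φ} → φ ∈ X → (□ φ) ∈ X

record Frame (ℓ : Level) : Set (lsuc ℓ) where
  field
    World : Set ℓ
    R     : Rel World ℓ

open Frame public

module _ where
  open Modal

  Valuation : Frame ℓ → Set (lsuc ℓ)
  Valuation {ℓ} 𝔽 = PVar → Pred (World 𝔽) ℓ

  -- The usual two-valued clauses, read in the metatheory. No classical
  -- principle is assumed, but a normal logic complete with respect to a
  -- nonempty frame contains p ∨ ∼ p, so Complete below entails excluded
  -- middle for Set ℓ whenever it is used with such a logic and frame.
  module Satisfaction (𝔽 : Frame ℓ) (V : Valuation 𝔽) where

    _⊩_ : World 𝔽 → Formula → Set ℓ
    w ⊩ var q   = V q w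
    w ⊩ (φ ∨ ψ) = (w ⊩ φ) ⊎ (w ⊩ ψ)
    w ⊩ (∼ φ)   = ¬ (w ⊩ φ)
    w ⊩ (□ φ)   = ∀ v → R 𝔽 w v → v ⊩ φ

  _⊨_ : Frame ℓ → Formula → Set (lsuc ℓ)
  𝔽 ⊨ φ = ∀ V w → let open Satisfaction 𝔽 V in w ⊩ φ

  Complete : {I : Set i} → Pred Formula x → (I → Frame ℓ) → Set (i ⊔ x ⊔ lsuc ℓ)
  Complete X F = ∀ χ → (χ ∈ X) ⇔ (∀ α → F α ⊨ χ)

  -- The injection sends a name variable a to its propositional variable p_a.
  module _ (p : Name ↣ PVar) where

    private
      pv : Name → Formula
      pv a = var (Injection.to p a)

    B : L₁.Formula → Formula
    B (L₁.ε a b) = pv a ∧ □ (pv a ⊃ pv b) ∧ (pv b ⊃ □ (pv b ⊃ pv a))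
    B (φ L₁.∨ ψ) = B φ ∨ B ψ
    B (L₁.∼ φ)   = ∼ B φ

    Faithful : Pred Formula x → Set x
    Faithful X = ∀ φ → B φ ∈ X → L₁.⊢ φ

Infinite : Set ℓ → Set ℓ
Infinite A = ∀ n → ¬ (Fin n ⤖ A)

-- The frames (G_i^*, R_i^*), up to the choice of the elements *, g_j, η_ij.
record IsStarFrame (i : ℕ) (𝔽 : Frame ℓ) : Set ℓ where
  field
    ⋆           : World 𝔽
    g           : Fin (suc i) → World 𝔽
    η           : ℕ → World 𝔽
    g-injective : Injective _≡_ _≡_ g
    η-injective : Injective _≡_ _≡_ η
    ⋆≢g         : ∀ j → ⋆ ≢ g j
    ⋆≢η         : ∀ k → ⋆ ≢ η k
    g≢η         : ∀ j k → g j ≢ η k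
    exhaustive  : ∀ w → w ≡ ⋆ ⊎ (∃ λ j → w ≡ g j) ⊎ (∃ λ k → w ≡ η k)
    R⇔          : ∀ v w → R 𝔽 v w ⇔
                    ((v ≡ ⋆ × ∃ λ j → w ≡ g j) ⊎ (∃ λ k → v ≡ η k × w ≡ η k))

-- Inclusion of the sets of frames enumerated by two families.
_⊆ᶠ_ : {J : Set x} {I : Set i} → (J → Frame ℓ) → (I → Frame ℓ) → Set (i ⊔ x ⊔ lsuc ℓ)
H ⊆ᶠ F = ∀ j → ∃ λ α → F α ≡ H j

{-# OPTIONS --safe #-}

-- Suppose φ is not provable in L₁, and let δ be a formula with ⊢ φ ⊃ δ that is
-- itself unprovable and such that the theory T = {ψ : ⊢ δ ∨ ψ} decides every
-- atom of φ; it is obtained by adding the atoms or their negations as disjuncts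
-- one after the other. T is closed under the axioms of L₁ and modus ponens. In
-- the star frame with points g_0, …, g_n, where n bounds the names in φ, make
-- p_a true at ⋆ if ε a a ∈ T and at g_j if ε j a ∈ T. The axioms of L₁ are
-- exactly what makes B (ε a b) hold at ⋆ if and only if ε a b ∈ T, so B φ fails
-- at ⋆. The classical reasoning is licensed by completeness of X, which turns
-- the theorem p ∨ ∼ p into excluded middle.

module Submission where

open import Defs
open import Axiom.DoubleNegationElimination using (em⇒dne)
open import Axiom.ExcludedMiddle using (ExcludedMiddle)
open import Data.Fin.Base using (toℕ; fromℕ<)
open import Data.Fin.Properties using (toℕ-fromℕ<)
open import Data.Nat.Base using (ℕ; _⊔_; _≤_; s≤s)
open import Data.Nat.Properties using (m⊔n≤o⇒m≤o; m⊔n≤o⇒n≤o; ≤-refl)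
open import Data.Product.Base using (_×_; _,_; ∃)
open import Data.Sum.Base using (_⊎_; inj₁; inj₂; [_,_]′; map)
open import Function.Base using (_∘_)
open import Function.Bundles using (_↣_; module Injection; module Equivalence)
open import Level using (Level; 0ℓ; lift; lower)
open import Relation.Binary.PropositionalEquality.Core using (_≡_; refl; sym; subst)
open import Relation.Nullary.Decidable.Core as Dec using (yes; no; fromSum; toSum)
open import Relation.Nullary.Negation.Core using (¬_; contradiction)
open import Relation.Unary using (Pred)

-- Kept general because it is instantiated at `⊢_`, at the theory `T δ` and at `K`.
module ClassicalTheory {t : Level} {Formula : Set}
  (_∨_ : Formula → Formula → Formula) (∼_ : Formula → Formula)
  (T : Pred Formula t) (axiom : ∀ {φ} → Classical.Axiom _∨_ ∼_ φ → T φ)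
  (mp : ∀ {φ ψ} → T ((∼ φ) ∨ ψ) → T φ → T ψ) where

  open Classical _∨_ ∼_

  private
    variable
      φ ψ χ : Formula

  ⊃-trans : T (φ ⊃ ψ) → T (ψ ⊃ χ) → T (φ ⊃ χ)
  ⊃-trans p q = mp (mp (axiom (sum _ _ _)) q) p

  ∨-introˡ : T (φ ⊃ (φ ∨ ψ))
  ∨-introˡ = axiom (weak _ _)

  ∨-introʳ : T (ψ ⊃ (φ ∨ ψ))
  ∨-introʳ = ⊃-trans ∨-introˡ (axiom (perm _ _))

  ⊃-refl : T (φ ⊃ φ)
  ⊃-refl = ⊃-trans ∨-introˡ (axiom (idem _))

  excluded-middle : T (φ ∨ (∼ φ))
  excluded-middle = mp (axiom (perm _ _)) ⊃-refl

  ∨-elim : T (φ ⊃ χ) → T (ψ ⊃ χ) → T ((φ ∨ ψ) ⊃ χ)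
  ∨-elim p q =
    ⊃-trans (mp (axiom (sum _ _ _)) q)
      (⊃-trans (axiom (perm _ _))
        (⊃-trans (mp (axiom (sum _ _ _)) p) (axiom (idem _))))

  ∨-swap : T ((φ ∨ (ψ ∨ χ)) ⊃ (ψ ∨ (φ ∨ χ)))
  ∨-swap = ∨-elim (⊃-trans ∨-introˡ ∨-introʳ)
                  (∨-elim ∨-introˡ (⊃-trans ∨-introʳ ∨-introʳ))

  explosion : T (∼ φ) → T φ → T ψ
  explosion p q = mp (mp ∨-introˡ p) q

  ∼∼-intro : T φ → T (∼ (∼ φ))
  -- Excluded middle for `∼ φ` unfolds to `φ ⊃ ∼ ∼ φ`.
  ∼∼-intro = mp excluded-middle

  ∼∨-intro : T (∼ φ) → T (∼ ψ) → T (∼ (φ ∨ ψ))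
  ∼∨-intro p q =
    mp (∨-elim (∨-elim (mp ∨-introˡ p) (mp ∨-introˡ q)) ⊃-refl) excluded-middle

  ∧-intro : T φ → T ψ → T (φ ∧ ψ)
  ∧-intro p q = ∼∨-intro (∼∼-intro p) (∼∼-intro q)

open L₁ using (ε; _∨_; ∼_; _⊃_; ⊢_; classical; ax1; ax2; ax3; mp)

open ClassicalTheory _∨_ ∼_ ⊢_ classical mp

-- T δ consists of the consequences of ∼ δ.
T : L₁.Formula → Pred L₁.Formula 0ℓ
T δ φ = ⊢ δ ∨ φ

T-theorem : ∀ {δ φ} → ⊢ φ → T δ φ
T-theorem = mp ∨-introʳ

T-mp : ∀ {δ φ ψ} → T δ (φ ⊃ ψ) → T δ φ → T δ ψ
-- `∨-swap` turns `δ ∨ (φ ⊃ ψ)` into `φ ⊃ (δ ∨ ψ)`.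
T-mp p q = mp (∨-elim ∨-introˡ (mp ∨-swap p)) q

T-mono : ∀ {δ δ′ φ} → ⊢ δ ⊃ δ′ → T δ φ → T δ′ φ
T-mono p = mp (∨-elim (⊃-trans p ∨-introˡ) ∨-introʳ)

DecidesAtoms : L₁.Formula → Pred L₁.Formula 0ℓ
DecidesAtoms δ (ε a b) = T δ (ε a b) ⊎ T δ (∼ ε a b)
DecidesAtoms δ (φ ∨ ψ) = DecidesAtoms δ φ × DecidesAtoms δ ψ
DecidesAtoms δ (∼ φ)   = DecidesAtoms δ φ

DecidesAtoms-mono : ∀ {δ δ′} → ⊢ δ ⊃ δ′ → ∀ φ → DecidesAtoms δ φ → DecidesAtoms δ′ φ
DecidesAtoms-mono p (ε a b) d       = map (T-mono p) (T-mono p) d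
DecidesAtoms-mono p (φ ∨ ψ) (d , e) = DecidesAtoms-mono p φ d , DecidesAtoms-mono p ψ e
DecidesAtoms-mono p (∼ φ)   d       = DecidesAtoms-mono p φ d

module _ (em : ExcludedMiddle 0ℓ) where

  -- At an atom, `∼ ε a b ∨ δ` and `ε a b ∨ δ` cannot both be provable, since a case distinction
  -- would give `δ`. The theory gains the opposite of the added disjunct.
  lindenbaum : ∀ φ δ → ¬ (⊢ δ) → ∃ λ δ′ → ⊢ δ ⊃ δ′ × ¬ (⊢ δ′) × DecidesAtoms δ′ φ
  lindenbaum (ε a b) δ ⊬δ with em {⊢ ∼ ε a b ∨ δ}
  ... | no  ⊬δ′  = ∼ ε a b ∨ δ , ∨-introʳ , ⊬δ′ ,
                   inj₁ (mp (∨-elim ∨-introʳ (⊃-trans ∨-introˡ ∨-introˡ)) excluded-middle)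
  ... | yes ⊢a⊃δ = ε a b ∨ δ , ∨-introʳ , ⊬δ ∘ mp (∨-elim ⊢a⊃δ ⊃-refl) ,
                   inj₂ (mp (∨-elim (⊃-trans ∨-introˡ ∨-introˡ) ∨-introʳ) excluded-middle)
  lindenbaum (φ ∨ ψ) δ ⊬δ =
    let δ₁ , p , ⊬δ₁ , d = lindenbaum φ δ ⊬δ
        δ₂ , q , ⊬δ₂ , e = lindenbaum ψ δ₁ ⊬δ₁
    in δ₂ , ⊃-trans p q , ⊬δ₂ , DecidesAtoms-mono q φ d , e
  lindenbaum (∼ φ) δ ⊬δ = lindenbaum φ δ ⊬δ

-- Only first arguments of ε count: the world g_a is needed to recover ε a b
-- from the inclusion of p_a in p_b.
nameBound : L₁.Formula → ℕ
nameBound (ε a b) = a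
nameBound (φ ∨ ψ) = nameBound φ ⊔ nameBound ψ
nameBound (∼ φ)   = nameBound φ

module TwoValued {ℓ : Level} (em : ExcludedMiddle ℓ) {P Q : Set ℓ} where

  ⊃-from : (P → Q) → ¬ P ⊎ Q
  ⊃-from f = [ inj₂ ∘ f , inj₁ ]′ (toSum em)

  ⊃-to : ¬ P ⊎ Q → P → Q
  ⊃-to (inj₁ ¬p) p = contradiction p ¬p
  ⊃-to (inj₂ q)  _ = q

  ∧-from : P → Q → ¬ (¬ P ⊎ ¬ Q)
  ∧-from p q = [ contradiction p , contradiction q ]′

  ∧-to : ¬ (¬ P ⊎ ¬ Q) → P × Q
  ∧-to n = em⇒dne em (n ∘ inj₁) , em⇒dne em (n ∘ inj₂)

module Countermodel {ℓ : Level} (em : ExcludedMiddle ℓ) (p : Name ↣ PVar)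
  {n : ℕ} {𝔽 : Frame ℓ} (star : IsStarFrame n 𝔽) (δ : L₁.Formula) where

  open IsStarFrame star
  open Injection p using (to; injective)
  private module Th = ClassicalTheory _∨_ ∼_ (T δ) (T-theorem ∘ classical) T-mp

  E : Name → Name → Set
  E a b = T δ (ε a b)

  E-exists : ∀ {a b} → E a b → E a a
  E-exists = T-mp (T-theorem (ax1 _ _))

  E-trans : ∀ {a b c} → E a b → E b c → E a c
  E-trans q r = T-mp (T-theorem (ax2 _ _ _)) (Th.∧-intro q r)

  E-sym : ∀ {a b c} → E a b → E b c → E b a
  E-sym q r = T-mp (T-theorem (ax3 _ _ _)) (Th.∧-intro q r)

  -- `p` need not be surjective: quantifying over the names sent to `q` makes every variable outside
  -- the range false everywhere.
  V : Valuation 𝔽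
  V q w = ∃ λ a → to a ≡ q × ((w ≡ ⋆ × E a a) ⊎ (∃ λ j → w ≡ g j × E (toℕ j) a))

  open Satisfaction 𝔽 V

  V-⋆-from : ∀ {a} → E a a → V (to a) ⋆
  V-⋆-from e = _ , refl , inj₁ (refl , e)

  V-⋆-to : ∀ {a} → V (to a) ⋆ → E a a
  V-⋆-to (_ , q , r) with refl ← injective q with r
  ... | inj₁ (_ , e)     = e
  ... | inj₂ (j , r , _) = contradiction r (⋆≢g j)

  V-g-from : ∀ {a} j → E (toℕ j) a → V (to a) (g j)
  V-g-from j e = _ , refl , inj₂ (j , refl , e)

  V-g-to : ∀ {a} j → V (to a) (g j) → E (toℕ j) a
  V-g-to j (_ , q , r) with refl ← injective q with r
  ... | inj₁ (r , _)     = contradiction (sym r) (⋆≢g j)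
  ... | inj₂ (_ , r , e) with refl ← g-injective r = e

  R-⋆-from : ∀ j → R 𝔽 ⋆ (g j)
  R-⋆-from j = Equivalence.from (R⇔ _ _) (inj₁ (refl , j , refl))

  R-⋆-to : ∀ {w} → R 𝔽 ⋆ w → ∃ λ j → w ≡ g j
  R-⋆-to r with Equivalence.to (R⇔ _ _) r
  ... | inj₁ (_ , s)     = s
  ... | inj₂ (k , s , _) = contradiction s (⋆≢η k)

  open TwoValued em

  inclusion : ∀ {a b} → E a b → ∀ w → R 𝔽 ⋆ w → ¬ V (to a) w ⊎ V (to b) w
  inclusion e w r with j , refl ← R-⋆-to r =
    ⊃-from (λ v → V-g-from j (E-trans (V-g-to j v) e))

  B-ε-from : ∀ {a b} → E a b → ⋆ ⊩ B p (ε a b)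
  B-ε-from e =
    ∧-from (V-⋆-from (E-exists e))
      (∧-from (inclusion e)
        -- `p_b` at `⋆` gives `E b b`, so the third axiom, with `c` equal to `b`, yields `E b a`.
        (⊃-from (λ v → inclusion (E-sym e (V-⋆-to v)))))

  -- `p_a` at `⋆` means `E a a`, which makes `p_a` true at `g_a`, a world that exists because
  -- `a ≤ n`. The boxed inclusion then gives `p_b` at `g_a`, that is, `E a b`.
  B-ε-to : ∀ {a b} → a ≤ n → ⋆ ⊩ B p (ε a b) → E a b
  B-ε-to {a} {b} a≤n s =
    let v , s′ = ∧-to s
        i , _  = ∧-to s′
        j      = fromℕ< (s≤s a≤n)
        j≡a    = toℕ-fromℕ< (s≤s a≤n)
    in subst (λ c → E c b) j≡a
         (V-g-to j (⊃-to (i (g j) (R-⋆-from j))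
           (V-g-from j (subst (λ c → E c a) (sym j≡a) (V-⋆-to v)))))

  module _ (⊬δ : ¬ (⊢ δ)) where

    consistent : ∀ {φ} → T δ φ → ¬ T δ (∼ φ)
    consistent q r = ⊬δ (mp (classical (L₁.idem δ)) (Th.explosion r q))

    -- Only atoms are assumed decided, so the induction carries the verdict of `T δ` along with the
    -- truth value at `⋆`.
    truth : ∀ φ → nameBound φ ≤ n → DecidesAtoms δ φ →
            (⋆ ⊩ B p φ × T δ φ) ⊎ (¬ (⋆ ⊩ B p φ) × T δ (∼ φ))
    truth (ε a b) _ (inj₁ e) = inj₁ (B-ε-from e , e)
    truth (ε a b) l (inj₂ e) = inj₂ ((λ s → consistent (B-ε-to l s) e) , e)
    truth (φ ∨ ψ) l (d , e)
      with truth φ (m⊔n≤o⇒m≤o (nameBound φ) (nameBound ψ) l) d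
         | truth ψ (m⊔n≤o⇒n≤o (nameBound φ) (nameBound ψ) l) e
    ... | inj₁ (s , q) | _            = inj₁ (inj₁ s , T-mp Th.∨-introˡ q)
    ... | inj₂ _       | inj₁ (s , q) = inj₁ (inj₂ s , T-mp Th.∨-introʳ q)
    ... | inj₂ (s , q) | inj₂ (t , r) = inj₂ ([ s , t ]′ , Th.∼∨-intro q r)
    truth (∼ φ) l d with truth φ l d
    ... | inj₁ (s , q) = inj₂ (contradiction s , Th.∼∼-intro q)
    ... | inj₂ (s , q) = inj₁ (s , q)

complete⇒em : ∀ {i x ℓ} {X : Pred Modal.Formula x} {I : Set i} {F : I → Frame ℓ} →
              Modal.IsNormal X → Complete X F → ∀ α → World (F α) → ExcludedMiddle ℓ
complete⇒em normal complete α w {P} =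
  -- Under the valuation constantly `P`, satisfaction of `var 0 ∨ ∼ var 0` is literally `P ⊎ ¬ P`.
  fromSum (Equivalence.to (complete _) (K⊆ (K.excluded-middle {Modal.var 0})) α (λ _ _ → P) w)
  where
  open Modal.IsNormal normal
  module K = ClassicalTheory Modal._∨_ Modal.∼_ Modal.K Modal.classical Modal.mp

theorem6p1 : {i x ℓ : Level} (p : Name ↣ PVar)
    (X : Pred Modal.Formula x) → Modal.IsNormal X →
    (I : Set i) → (ℕ ↣ I) →
    (F : I → Frame ℓ) →
    (∀ α → World (F α)) → (∀ α → Infinite (World (F α))) →
    Complete X F →
    (H : ℕ → Frame ℓ) → (∀ n → IsStarFrame n (H n)) →
    H ⊆ᶠ F →
    Faithful p X
theorem6p1 {ℓ = ℓ} p X normal I ω↣I F world _ complete H star H⊆F φ Bφ∈X =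
  em⇒dne em₀ refute
  where
  em : ExcludedMiddle ℓ
  em = let α = Injection.to ω↣I 0 in complete⇒em normal complete α (world α)

  -- Provability in `L₁` lives at level `0ℓ`, satisfaction at level `ℓ`.
  em₀ : ExcludedMiddle 0ℓ
  em₀ = Dec.map′ lower lift em

  n : ℕ
  n = nameBound φ

  valid : H n ⊨ B p φ
  valid = let α , Fα≡Hn = H⊆F n in
    subst (_⊨ B p φ) Fα≡Hn (Equivalence.to (complete (B p φ)) Bφ∈X α)

  refute : ¬ ¬ (⊢ φ)
  refute ⊬φ with δ , φ⊃δ , ⊬δ , d ← lindenbaum em₀ φ φ ⊬φ
    with Countermodel.truth em p (star n) δ ⊬δ φ ≤-refl d
  -- Since the extension started from `φ`, having `δ ∨ φ` provable would prove `δ`.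
  ... | inj₁ (_ , φ∈T) = ⊬δ (mp (∨-elim ⊃-refl φ⊃δ) φ∈T)
  ... | inj₂ (⊮Bφ , _) = ⊮Bφ (valid (Countermodel.V em p (star n) δ) _)
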